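{- Let $\Gamma$ be a graph and $C=\{v_1,\dots,v_7\}$ a subset of $7$ of its vertices. Let $\pi$ be the cyclic permutation $v_i\mapsto v_{i+1}$ (indices modulo $7$). Define $\ell=\{v_1,v_2,v_4\}$, $\mathcal{O}=\{v_3,v_5,v_6\}$, and $\ell_i=\pi^i(\ell)$, $\mathcal{O}_i=\pi^i(\mathcal{O})$ for $i\in\mathbb{Z}/7\mathbb{Z}$. (The set $C$ with the "lines" $\ell_i$ is the Fano plane $\mathrm{PG}(2,2)$.) Suppose that: (i) The induced subgraph on $C$ has one of the following edge sets: (a) $\{v_1v_2,\,v_2v_3,\,v_3v_4,\,v_4v_5,\,v_5v_6,\,v_6v_7,\,v_7v_1\}$; (b) $\{v_3v_4,\,v_4v_5,\,v_1v_6,\,v_3v_6,\,v_5v_6,\,v_1v_7,\,v_2v_7,\,v_3v_7,\,v_4v_7,\,v_6v_7\}$. (ii) For every vertex $v$ outside $C$, the set of neighbours of $v$ in $C$ is either $C$, or $\emptyset$, or a line $\ell_i$, or the complement $C\setminus\ell_i$ of a line. Construct $\Gamma'$ from $\Gamma$ on the same vertex set as follows, leaving all other adjacencies unchanged. For every $v$ outside $C$ whose neighbourhood in $C$ is $\ell_i$, change its neighbourhood in $C$ to $\mathcal{O}_i$; for every $v$ outside $C$ whose neighbourhood in $C$ is $C\setminus\ell_i$, change its neighbourhood in $C$ to $C\setminus\mathcal{O}_i$. In case (b), replace the induced subgraph on $C$ by the graph with edge set $$\{v_3v_4,\,v_4v_5,\,v_2v_3,\,v_2v_5,\,v_2v_7,\,v_1v_2,\,v_1v_4,\,v_1v_5,\,v_1v_6,\,v_1v_7\}.$$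 Then $\Gamma'$ is $\mathbb{R}$-cospectral with $\Gamma$.
   Context: Graphs are finite, simple and loopless. Two graphs with adjacency matrices $A$ and $A'$ are $\mathbb{R}$-cospectral if $A+rJ$ and $A'+rJ$ have the same spectrum for every $r\in\mathbb{R}$, where $J$ is the all-ones matrix. -}

module Defs where

open import Algebra.Bundles using (CommutativeRing)
import Algebra.Properties.Monoid.Sum as Sum
open import Algebra.Structures using (IsMonoid; IsAbelianGroup; IsCommutativeRing)
open import Data.Bool.Base using (Bool; true; false; if_then_else_)
import Data.Bool.Properties as Bool
open import Data.Fin.Base using (Fin; toℕ)
import Data.Fin.Properties as Fin
open import Data.Fin.Subset using (Subset; ⊤; ⊥; ∁; ⁅_⁆; ⋃)
open import Data.List.Base as List using (List; []; _∷_)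
import Data.List.Membership.DecPropositional as DecMembership
open import Data.Nat.Base as ℕ using (ℕ; suc)
open import Data.Nat.DivMod using (_mod_)
open import Data.Nat.GeneralisedArithmetic using (iterate)
import Data.Nat.Properties as ℕ
open import Data.Product.Base using (_×_; _,_; proj₁; proj₂; ∃-syntax; map)
import Data.Product.Properties as Product
open import Data.Rational.Base as ℚ using (ℚ; 0ℚ; 1ℚ; ½; ∣_∣)
import Data.Rational.Properties as ℚ
open import Data.Rational.Solver using (module +-*-Solver)
open import Data.Sum.Base as ⊎ using (_⊎_)
open import Data.Vec.Base using (tabulate; lookup)
open import Data.Vec.Functional using (Vector)
import Data.Vec.Properties as Vec
open import Function.Bundles using (_⇔_; mk⇔)
open import Level using (0ℓ)
open import Relation.Binary.Definitions using (DecidableEquality)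
open import Relation.Binary.PropositionalEquality
  using (_≡_; refl; sym; trans; cong; subst)
open import Relation.Nullary.Decidable
  using (Dec; yes; no; does; does-⇔; from-yes; _⊎-dec_)

-- A real number is a Cauchy sequence of rationals; two are equal when their
-- difference tends to 0.

IsCauchy : (ℕ → ℚ) → Set
IsCauchy x = ∀ ε → 0ℚ ℚ.< ε →
  ∃[ N ] ∀ m n → N ℕ.≤ m → N ℕ.≤ n → ∣ x m ℚ.- x n ∣ ℚ.< ε

record ℝ : Set where
  no-eta-equality
  field
    seq    : ℕ → ℚ
    cauchy : IsCauchy seq

open ℝ public

infix 4 _≈ℝ_

record _≈ℝ_ (x y : ℝ) : Set where
  no-eta-equality
  pattern
  constructor mk≈
  field
    null : ∀ ε → 0ℚ ℚ.< ε →
      ∃[ N ] ∀ n → N ℕ.≤ n → ∣ seq x n ℚ.- seq y n ∣ ℚ.< ε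

private

  Small : (ℕ → ℕ → ℚ) → Set
  Small f = ∀ ε → 0ℚ ℚ.< ε →
    ∃[ N ] ∀ m n → N ℕ.≤ m → N ℕ.≤ n → ∣ f m n ∣ ℚ.< ε

  Bounded : (ℕ → ℕ → ℚ) → Set
  Bounded f = ∃[ B ] (0ℚ ℚ.< B × ∃[ N ] ∀ m n → N ℕ.≤ m → N ℕ.≤ n → ∣ f m n ∣ ℚ.< B)

  ≤⊔ˡ : ∀ {M N k} → M ℕ.⊔ N ℕ.≤ k → M ℕ.≤ k
  ≤⊔ˡ {M} {N} = ℕ.≤-trans (ℕ.m≤m⊔n M N)

  ≤⊔ʳ : ∀ {M N k} → M ℕ.⊔ N ℕ.≤ k → N ℕ.≤ k
  ≤⊔ʳ {M} {N} = ℕ.≤-trans (ℕ.m≤n⊔m M N)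

  halves : ∀ ε → ε ℚ.* ½ ℚ.+ ε ℚ.* ½ ≡ ε
  halves ε = trans (sym (ℚ.*-distribˡ-+ ε ½ ½)) (ℚ.*-identityʳ ε)

  0<half : ∀ {ε} → 0ℚ ℚ.< ε → 0ℚ ℚ.< ε ℚ.* ½
  0<half {ε} 0<ε = subst (ℚ._< ε ℚ.* ½) (ℚ.*-zeroˡ ½) (ℚ.*-monoˡ-<-pos ½ 0<ε)

  small-resp : ∀ {f g} → (∀ m n → f m n ≡ g m n) → Small f → Small g
  small-resp f≗g sf ε 0<ε with sf ε 0<ε
  ... | N , p = N , λ m n M≤ N≤ →
    subst (λ q → ∣ q ∣ ℚ.< ε) (f≗g m n) (p m n M≤ N≤)

  small-+ : ∀ {f g} → Small f → Small g → Small (λ m n → f m n ℚ.+ g m n)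
  small-+ {f} {g} sf sg ε 0<ε
    with sf (ε ℚ.* ½) (0<half 0<ε) | sg (ε ℚ.* ½) (0<half 0<ε)
  ... | M , p | N , q = M ℕ.⊔ N , λ m n a b → ℚ.≤-<-trans
    (ℚ.∣p+q∣≤∣p∣+∣q∣ (f m n) (g m n))
    (subst (∣ f m n ∣ ℚ.+ ∣ g m n ∣ ℚ.<_) (halves ε)
      (ℚ.+-mono-< (p m n (≤⊔ˡ a) (≤⊔ˡ b))
                  (q m n (≤⊔ʳ {M} a) (≤⊔ʳ {M} b))))

  small-neg : ∀ {f} → Small f → Small (λ m n → ℚ.- f m n)
  small-neg {f} sf ε 0<ε with sf ε 0<ε
  ... | N , p = N , λ m n a b →
    subst (ℚ._< ε) (sym (ℚ.∣-p∣≡∣p∣ (f m n))) (p m n a b)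

  small-* : ∀ {f g} → Bounded f → Small g → Small (λ m n → f m n ℚ.* g m n)
  small-* {f} {g} (B , 0<B , M , bf) sg ε 0<ε = M ℕ.⊔ proj₁ s , λ m n a b →
    subst (ℚ._< ε) (sym (ℚ.∣p*q∣≡∣p∣*∣q∣ (f m n) (g m n)))
      (ℚ.≤-<-trans
        (ℚ.*-monoʳ-≤-nonNeg ∣ g m n ∣ ⦃ ℚ.∣-∣-nonNeg (g m n) ⦄
          (ℚ.<⇒≤ (bf m n (≤⊔ˡ a) (≤⊔ˡ b))))
        (subst (B ℚ.* ∣ g m n ∣ ℚ.<_) B*δ≡ε
          (ℚ.*-monoʳ-<-pos B (proj₂ s m n (≤⊔ʳ {M} a) (≤⊔ʳ {M} b)))))
    where
    instance
      posB : ℚ.Positive B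
      posB = ℚ.positive 0<B
      nzB : ℚ.NonZero B
      nzB = ℚ.pos⇒nonZero B
      posB⁻¹ : ℚ.Positive (ℚ.1/ B)
      posB⁻¹ = ℚ.1/pos⇒pos B
    δ : ℚ
    δ = ε ℚ.* ℚ.1/ B
    0<δ : 0ℚ ℚ.< δ
    0<δ = subst (ℚ._< δ) (ℚ.*-zeroˡ (ℚ.1/ B)) (ℚ.*-monoˡ-<-pos (ℚ.1/ B) 0<ε)
    s : ∃[ N ] ∀ m n → N ℕ.≤ m → N ℕ.≤ n → ∣ g m n ∣ ℚ.< δ
    s = sg δ 0<δ
    B*δ≡ε : B ℚ.* δ ≡ ε
    B*δ≡ε = trans (ℚ.*-comm B δ) (trans (ℚ.*-assoc ε (ℚ.1/ B) B)
      (trans (cong (ε ℚ.*_) (ℚ.*-inverseˡ B)) (ℚ.*-identityʳ ε)))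

  ∣p∣<∣q∣+1 : ∀ p q → ∣ p ℚ.- q ∣ ℚ.< 1ℚ → ∣ p ∣ ℚ.< ∣ q ∣ ℚ.+ 1ℚ
  ∣p∣<∣q∣+1 p q h = ℚ.≤-<-trans
    (subst (λ z → ∣ z ∣ ℚ.≤ ∣ q ∣ ℚ.+ ∣ p ℚ.- q ∣) eq (ℚ.∣p+q∣≤∣p∣+∣q∣ q (p ℚ.- q)))
    (ℚ.+-monoʳ-< ∣ q ∣ h)
    where
    open +-*-Solver
    eq : q ℚ.+ (p ℚ.- q) ≡ p
    eq = solve 2 (λ p q → q :+ (p :- q) := p) refl p q

  abstract
    cauchy-bounded : (x : ℝ) →
      ∃[ B ] (0ℚ ℚ.< B × ∃[ N ] ∀ n → N ℕ.≤ n → ∣ seq x n ∣ ℚ.< B)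
    cauchy-bounded x with cauchy x 1ℚ (ℚ.positive⁻¹ 1ℚ)
    ... | N , p =
        ∣ seq x N ∣ ℚ.+ 1ℚ
      , ℚ.≤-<-trans (ℚ.0≤∣p∣ (seq x N))
          (subst (ℚ._< ∣ seq x N ∣ ℚ.+ 1ℚ) (ℚ.+-identityʳ ∣ seq x N ∣)
            (ℚ.+-monoʳ-< ∣ seq x N ∣ (ℚ.positive⁻¹ 1ℚ)))
      , N , λ n N≤n → ∣p∣<∣q∣+1 (seq x n) (seq x N) (p n N N≤n ℕ.≤-refl)

  bounded₁ : (x : ℝ) → Bounded (λ m n → seq x m)
  bounded₁ x = let B , 0<B , N , p = cauchy-bounded x in B , 0<B , N , λ m n a _ → p m a

  bounded₂ : (x : ℝ) → Bounded (λ m n → seq x n)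
  bounded₂ x = let B , 0<B , N , p = cauchy-bounded x in B , 0<B , N , λ m n _ b → p n b

  toSmall : ∀ {x y} → x ≈ℝ y → Small (λ m n → seq x m ℚ.- seq y m)
  toSmall (mk≈ h) ε 0<ε with h ε 0<ε
  ... | N , p = N , λ m n a b → p m a

  fromSmall : ∀ {x y} → Small (λ m n → seq x m ℚ.- seq y m) → x ≈ℝ y
  fromSmall s = mk≈ λ ε 0<ε → map (λ N → N) (λ p n a → p n n a a) (s ε 0<ε)

  module Identities where
    open +-*-Solver

    sum-diff : ∀ a b c d → (a ℚ.- c) ℚ.+ (b ℚ.- d) ≡ (a ℚ.+ b) ℚ.- (c ℚ.+ d)
    sum-diff = solve 4 (λ a b c d → (a :- c) :+ (b :- d) := (a :+ b) :- (c :+ d)) refl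

    neg-diff : ∀ a b → ℚ.- (a ℚ.- b) ≡ ℚ.- a ℚ.- ℚ.- b
    neg-diff = solve 2 (λ a b → :- (a :- b) := :- a :- :- b) refl

    swap-diff : ∀ a b → ℚ.- (a ℚ.- b) ≡ b ℚ.- a
    swap-diff = solve 2 (λ a b → :- (a :- b) := b :- a) refl

    trans-diff : ∀ a b c → (a ℚ.- b) ℚ.+ (b ℚ.- c) ≡ a ℚ.- c
    trans-diff = solve 3 (λ a b c → (a :- b) :+ (b :- c) := a :- c) refl

    prod-diff : ∀ a b c d →
      a ℚ.* (b ℚ.- d) ℚ.+ d ℚ.* (a ℚ.- c) ≡ a ℚ.* b ℚ.- c ℚ.* d
    prod-diff = solve 4 (λ a b c d →
      a :* (b :- d) :+ d :* (a :- c) := a :* b :- c :* d) refl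

  open Identities

infixl 7 _*ℝ_
infixl 6 _+ℝ_
infix  8 -ℝ_

fromℚ : ℚ → ℝ
seq    (fromℚ q) _ = q
cauchy (fromℚ q) ε 0<ε =
  0 , λ _ _ _ _ → subst (λ z → ∣ z ∣ ℚ.< ε) (sym (ℚ.+-inverseʳ q)) 0<ε

0ℝ 1ℝ : ℝ
0ℝ = fromℚ 0ℚ
1ℝ = fromℚ 1ℚ

_+ℝ_ : ℝ → ℝ → ℝ
seq    (x +ℝ y) n = seq x n ℚ.+ seq y n
cauchy (x +ℝ y) = small-resp
  (λ m n → sum-diff (seq x m) (seq y m) (seq x n) (seq y n))
  (small-+ (cauchy x) (cauchy y))

-ℝ_ : ℝ → ℝ
seq    (-ℝ x) n = ℚ.- seq x n
cauchy (-ℝ x) = small-resp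
  (λ m n → neg-diff (seq x m) (seq x n)) (small-neg (cauchy x))

_*ℝ_ : ℝ → ℝ → ℝ
seq    (x *ℝ y) n = seq x n ℚ.* seq y n
cauchy (x *ℝ y) = small-resp
  (λ m n → prod-diff (seq x m) (seq y m) (seq x n) (seq y n))
  (small-+ (small-* (bounded₁ x) (cauchy y)) (small-* (bounded₂ y) (cauchy x)))

private

  pointwise : ∀ {x y} → (∀ n → seq x n ≡ seq y n) → x ≈ℝ y
  pointwise {x} {y} x≗y = mk≈ λ ε 0<ε → 0 , λ n _ →
    subst (λ z → ∣ z ∣ ℚ.< ε)
      (sym (trans (cong (ℚ._- seq y n) (x≗y n)) (ℚ.+-inverseʳ (seq y n)))) 0<ε

  ≈-sym : ∀ {x y} → x ≈ℝ y → y ≈ℝ x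
  ≈-sym {x} {y} p = fromSmall
    (small-resp (λ m _ → swap-diff (seq x m) (seq y m)) (small-neg (toSmall p)))

  ≈-trans : ∀ {x y z} → x ≈ℝ y → y ≈ℝ z → x ≈ℝ z
  ≈-trans {x} {y} {z} p q = fromSmall
    (small-resp (λ m _ → trans-diff (seq x m) (seq y m) (seq z m))
      (small-+ (toSmall p) (toSmall q)))

  +-cong : ∀ {x y u v} → x ≈ℝ y → u ≈ℝ v → x +ℝ u ≈ℝ y +ℝ v
  +-cong {x} {y} {u} {v} p q = fromSmall
    (small-resp (λ m _ → sum-diff (seq x m) (seq u m) (seq y m) (seq v m))
      (small-+ (toSmall p) (toSmall q)))

  -‿cong : ∀ {x y} → x ≈ℝ y → -ℝ x ≈ℝ -ℝ y
  -‿cong {x} {y} p = fromSmall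
    (small-resp (λ m _ → neg-diff (seq x m) (seq y m)) (small-neg (toSmall p)))

  *-cong : ∀ {x y u v} → x ≈ℝ y → u ≈ℝ v → x *ℝ u ≈ℝ y *ℝ v
  *-cong {x} {y} {u} {v} p q = fromSmall
    (small-resp (λ m _ → prod-diff (seq x m) (seq u m) (seq y m) (seq v m))
      (small-+ (small-* (bounded₁ x) (toSmall q)) (small-* (bounded₁ v) (toSmall p))))

  +-isMonoid : IsMonoid _≈ℝ_ _+ℝ_ 0ℝ
  +-isMonoid = record
    { isSemigroup = record
      { isMagma = record
        { isEquivalence = record
          { refl  = pointwise λ _ → refl
          ; sym   = ≈-sym
          ; trans = ≈-trans
          }
        ; ∙-cong = +-cong
        }
      ; assoc = λ x y z → pointwise λ n → ℚ.+-assoc (seq x n) (seq y n) (seq z n)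
      }
    ; identity = (λ x → pointwise λ n → ℚ.+-identityˡ (seq x n))
               , (λ x → pointwise λ n → ℚ.+-identityʳ (seq x n))
    }

  +-isAbelianGroup : IsAbelianGroup _≈ℝ_ _+ℝ_ 0ℝ -ℝ_
  +-isAbelianGroup = record
    { isGroup = record
      { isMonoid = +-isMonoid
      ; inverse  = (λ x → pointwise λ n → ℚ.+-inverseˡ (seq x n))
                 , (λ x → pointwise λ n → ℚ.+-inverseʳ (seq x n))
      ; ⁻¹-cong  = -‿cong
      }
    ; comm = λ x y → pointwise λ n → ℚ.+-comm (seq x n) (seq y n)
    }

  isCommutativeRing : IsCommutativeRing _≈ℝ_ _+ℝ_ _*ℝ_ -ℝ_ 0ℝ 1ℝ
  isCommutativeRing = record
    { isRing = record
      { +-isAbelianGroup = +-isAbelianGroup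
      ; *-cong     = *-cong
      ; *-assoc    = λ x y z → pointwise λ n → ℚ.*-assoc (seq x n) (seq y n) (seq z n)
      ; *-identity = (λ x → pointwise λ n → ℚ.*-identityˡ (seq x n))
                   , (λ x → pointwise λ n → ℚ.*-identityʳ (seq x n))
      ; distrib    = (λ x y z → pointwise λ n → ℚ.*-distribˡ-+ (seq x n) (seq y n) (seq z n))
                   , (λ x y z → pointwise λ n → ℚ.*-distribʳ-+ (seq x n) (seq y n) (seq z n))
      }
    ; *-comm = λ x y → pointwise λ n → ℚ.*-comm (seq x n) (seq y n)
    }

ℝ-commutativeRing : CommutativeRing 0ℓ 0ℓ
ℝ-commutativeRing = record { isCommutativeRing = isCommutativeRing }

open Sum (CommutativeRing.+-monoid ℝ-commutativeRing) public using (sum)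

Matrix : ℕ → Set
Matrix n = Fin n → Fin n → ℝ

infix 4 _≋_
_≋_ : ∀ {n} → Vector ℝ n → Vector ℝ n → Set
x ≋ y = ∀ i → x i ≈ℝ y i

_·_ : ∀ {n} → Matrix n → Vector ℝ n → Vector ℝ n
(M · x) i = sum λ j → M i j *ℝ x j

_∈Eigenspace[_,_] : ∀ {n} → Vector ℝ n → Matrix n → ℝ → Set
x ∈Eigenspace[ M , μ ] = M · x ≋ λ i → μ *ℝ x i

combination : ∀ {k n} → Vector ℝ k → (Fin k → Vector ℝ n) → Vector ℝ n
combination a b i = sum λ s → a s *ℝ b s i

-- The eigenspace of M for μ has dimension k; k = 0 says that μ is not an
-- eigenvalue.  SameSpectrum is only applied to real symmetric matrices, for
-- which geometric and algebraic multiplicities agree.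
record HasMultiplicity {n} (M : Matrix n) (μ : ℝ) (k : ℕ) : Set where
  field
    basis       : Fin k → Vector ℝ n
    eigen       : ∀ s → basis s ∈Eigenspace[ M , μ ]
    independent : ∀ a → combination a basis ≋ (λ _ → 0ℝ) → a ≋ (λ _ → 0ℝ)
    spanning    : ∀ x → x ∈Eigenspace[ M , μ ] → ∃[ a ] x ≋ combination a basis

SameSpectrum : ∀ {n} → Matrix n → Matrix n → Set
SameSpectrum M M′ = ∀ μ k → HasMultiplicity M μ k ⇔ HasMultiplicity M′ μ k

record Graph (n : ℕ) : Set where
  field
    adj     : Fin n → Fin n → Bool
    adj-sym : ∀ u w → adj u w ≡ adj w u
    adj-irr : ∀ u → adj u u ≡ false

open Graph public

adjacency : ∀ {n} → Graph n → Matrix n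
adjacency Γ u w = if adj Γ u w then 1ℝ else 0ℝ

_+[_]J : ∀ {n} → Matrix n → ℝ → Matrix n
(A +[ r ]J) u w = A u w +ℝ r

ℝ-Cospectral : ∀ {n} → Graph n → Graph n → Set
ℝ-Cospectral Γ Γ′ = ∀ r → SameSpectrum (adjacency Γ +[ r ]J) (adjacency Γ′ +[ r ]J)

-- Residues modulo 7, so that the point v₇ has index 0.
ℤ/7 : Set
ℤ/7 = Fin 7

residue : ℕ → ℤ/7
residue m = m mod 7

π : ℤ/7 → ℤ/7
π i = residue (suc (toℕ i))

-- πⁱ applied to the set of points with the given labels.
shifted : List ℕ → ℤ/7 → Subset 7
shifted xs i = ⋃ (List.map (λ m → ⁅ iterate π (residue m) (toℕ i) ⁆) xs)

ℓ 𝒪 : ℤ/7 → Subset 7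
ℓ = shifted (1 ∷ 2 ∷ 4 ∷ [])
𝒪 = shifted (3 ∷ 5 ∷ 6 ∷ [])

data Case : Set where
  caseA caseB : Case

EdgeSet : Set
EdgeSet = List (ℤ/7 × ℤ/7)

edgeSet : List (ℕ × ℕ) → EdgeSet
edgeSet = List.map (map residue residue)

edges : Case → EdgeSet
edges caseA = edgeSet
  ((1 , 2) ∷ (2 , 3) ∷ (3 , 4) ∷ (4 , 5) ∷ (5 , 6) ∷ (6 , 7) ∷ (7 , 1) ∷ [])
edges caseB = edgeSet
  ((3 , 4) ∷ (4 , 5) ∷ (1 , 6) ∷ (3 , 6) ∷ (5 , 6) ∷
   (1 , 7) ∷ (2 , 7) ∷ (3 , 7) ∷ (4 , 7) ∷ (6 , 7) ∷ [])

newEdges : EdgeSet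
newEdges = edgeSet
  ((3 , 4) ∷ (4 , 5) ∷ (2 , 3) ∷ (2 , 5) ∷ (2 , 7) ∷
   (1 , 2) ∷ (1 , 4) ∷ (1 , 5) ∷ (1 , 6) ∷ (1 , 7) ∷ [])

infix 4 _≟²_
_≟²_ : DecidableEquality (ℤ/7 × ℤ/7)
_≟²_ = Product.≡-dec Fin._≟_ Fin._≟_

open DecMembership _≟²_ using (_∈_; _∈?_)

Joined : EdgeSet → ℤ/7 → ℤ/7 → Set
Joined E i j = (i , j) ∈ E ⊎ (j , i) ∈ E

joined? : ∀ E i j → Dec (Joined E i j)
joined? E i j = ((i , j) ∈? E) ⊎-dec ((j , i) ∈? E)

module _ {n} (v : ℤ/7 → Fin n) where

  InC : Fin n → Set
  InC u = ∃[ i ] v i ≡ u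

  inC? : ∀ u → Dec (InC u)
  inC? u = Fin.any? λ i → v i Fin.≟ u

module _ {n} (Γ : Graph n) (v : ℤ/7 → Fin n) where

  Induces : EdgeSet → Set
  Induces E = ∀ i j → adj Γ (v i) (v j) ≡ true ⇔ Joined E i j

  nbhd : Fin n → Subset 7
  nbhd u = tabulate λ i → adj Γ u (v i)

data Admissible : Subset 7 → Set where
  full   : Admissible ⊤
  empty  : Admissible ⊥
  line   : ∀ i → Admissible (ℓ i)
  coline : ∀ i → Admissible (∁ (ℓ i))

infix 4 _≟ₛ_
_≟ₛ_ : DecidableEquality (Subset 7)
_≟ₛ_ = Vec.≡-dec Bool._≟_

switchNbhd : Subset 7 → Subset 7
switchNbhd S with Fin.any? (λ i → S ≟ₛ ℓ i) | Fin.any? (λ i → S ≟ₛ ∁ (ℓ i))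
... | yes (i , _) | _           = 𝒪 i
... | no _        | yes (i , _) = ∁ (𝒪 i)
... | no _        | no _        = S

module _ {n} (Γ : Graph n) (v : ℤ/7 → Fin n) where

  insideAdj : Case → ℤ/7 → ℤ/7 → Bool
  insideAdj caseA i j = adj Γ (v i) (v j)
  insideAdj caseB i j = does (joined? newEdges i j)

  switchAdj : Case → ∀ {u w} → Dec (InC v u) → Dec (InC v w) → Bool
  switchAdj c         (yes (i , _)) (yes (j , _)) = insideAdj c i j
  switchAdj c {w = w} (yes (i , _)) (no _)        = lookup (switchNbhd (nbhd Γ v w)) i
  switchAdj c {u = u} (no _)        (yes (j , _)) = lookup (switchNbhd (nbhd Γ v u)) j
  switchAdj c {u} {w} (no _)        (no _)        = adj Γ u w

  private

    insideAdj-sym : ∀ c i j → insideAdj c i j ≡ insideAdj c j i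
    insideAdj-sym caseA i j = adj-sym Γ (v i) (v j)
    insideAdj-sym caseB i j =
      does-⇔ (mk⇔ ⊎.swap ⊎.swap) (joined? newEdges i j) (joined? newEdges j i)

    insideAdj-irr : ∀ c i → insideAdj c i i ≡ false
    insideAdj-irr caseA i = adj-irr Γ (v i)
    insideAdj-irr caseB i =
      from-yes (Fin.all? λ i → does (joined? newEdges i i) Bool.≟ false) i

    switchAdj-sym : ∀ c {u w} (d : Dec (InC v u)) (e : Dec (InC v w)) →
                    switchAdj c d e ≡ switchAdj c e d
    switchAdj-sym c (yes (i , _)) (yes (j , _)) = insideAdj-sym c i j
    switchAdj-sym c (yes _)       (no _)        = refl
    switchAdj-sym c (no _)        (yes _)       = refl
    switchAdj-sym c {u} {w} (no _) (no _)       = adj-sym Γ u w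

    switchAdj-irr : ∀ c {u} (d : Dec (InC v u)) → switchAdj c d d ≡ false
    switchAdj-irr c (yes (i , _)) = insideAdj-irr c i
    switchAdj-irr c {u} (no _)    = adj-irr Γ u

  fanoSwitch : Case → Graph n
  fanoSwitch c = record
    { adj     = λ u w → switchAdj c (inC? v u) (inC? v w)
    ; adj-sym = λ u w → switchAdj-sym c (inC? v u) (inC? v w)
    ; adj-irr = λ u → switchAdj-irr c (inC? v u)
    }

{-# OPTIONS --safe #-}

-- Let Q be the circulant matrix ½ (L − I), where L is the incidence matrix of
-- the Fano plane.  It is orthogonal with row and column sums 1, and it maps the
-- indicator vector of ℓ i to that of 𝒪 i.  Hence the orthogonal operator T that
-- acts as Q on the coordinates in C and as the identity elsewhere fixes the
-- all-ones vector and satisfies T A = A′ T: off C this is the switching rule,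
-- and on C it is the identity Q B = B′ Q between the induced subgraphs.  So T
-- conjugates A + r J to A′ + r J for every r.

module Submission where

open import Defs
open import Algebra.Bundles using (CommutativeRing)
import Algebra.Properties.CommutativeSemigroup as CommutativeSemigroup
import Algebra.Properties.Monoid.Sum as MonoidSum
import Algebra.Properties.Semiring.Sum as SemiringSum
open import Data.Bool.Base using (Bool; true; false; if_then_else_)
open import Data.Fin.Base using (Fin; punchIn)
import Data.Fin.Properties as Fin
open import Data.Fin.Subset using (Subset; ⊤; ⊥; ∁)
open import Data.Nat.Base using (ℕ; zero; suc)
open import Data.Product.Base using (_×_; _,_; proj₁; proj₂; ∃-syntax)
open import Data.Rational.Base as ℚ using (ℚ; 0ℚ; 1ℚ; ½)
import Data.Rational.Properties as ℚ
open import Data.Vec.Base using (lookup)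
open import Data.Vec.Functional using (Vector)
open import Data.Vec.Properties using (lookup∘tabulate)
open import Function.Base using (_∘_; flip)
open import Function.Bundles using (_⇔_; mk⇔; Equivalence)
open import Function.Definitions using (Injective)
open import Relation.Binary.PropositionalEquality as ≡ using (_≡_; _≢_)
import Relation.Binary.Reasoning.Setoid as SetoidReasoning
open import Relation.Nullary.Decidable
  using (Dec; yes; no; does; dec-true; dec-false; from-yes; ¬?; _×-dec_)
open import Relation.Nullary.Negation using (¬_; contradiction)

open CommutativeRing ℝ-commutativeRing
  using (setoid; refl; sym; trans; reflexive; semiring; *-commutativeSemigroup;
         +-cong; +-congˡ; +-congʳ; +-identityˡ; +-identityʳ;
         *-cong; *-congˡ; *-congʳ; *-comm; *-identityˡ; zeroˡ; zeroʳ; distribˡ)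
open SemiringSum semiring
  using (sum-cong-≋; sum-remove; sum-replicate-zero; ∑-comm; ∑-distrib-+;
         *-distribˡ-sum; *-distribʳ-sum)
open CommutativeSemigroup *-commutativeSemigroup using (x∙yz≈y∙xz)
open MonoidSum ℚ.+-0-monoid using () renaming (sum to sumℚ)
open SetoidReasoning setoid

private
  variable
    k m n : ℕ

≋-trans : {x y z : Vector ℝ n} → x ≋ y → y ≋ z → x ≋ z
≋-trans p q i = trans (p i) (q i)

infix 5 _when_
_when_ : {A : Set} → ℝ → Dec A → ℝ
x when d = if does d then x else 0ℝ

when-yes : {A : Set} {x : ℝ} (d : Dec A) → A → x when d ≈ℝ x
when-yes d a rewrite dec-true d a = refl

when-no : {A : Set} {x : ℝ} (d : Dec A) → ¬ A → x when d ≈ℝ 0ℝ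
when-no d ¬a rewrite dec-false d ¬a = refl

sum-zero : {t : Vector ℝ m} → (∀ j → t j ≈ℝ 0ℝ) → sum t ≈ℝ 0ℝ
sum-zero {m} t≈0 = trans (sum-cong-≋ t≈0) (sum-replicate-zero m)

sum-single : (t : Vector ℝ m) (i : Fin m) → (∀ j → j ≢ i → t j ≈ℝ 0ℝ) → sum t ≈ℝ t i
sum-single {suc m} t i t≈0 = begin
  sum t                                ≈⟨ sum-remove {i = i} t ⟩
  t i +ℝ sum (λ j → t (punchIn i j))   ≈⟨ +-congˡ (sum-zero λ j → t≈0 _ (Fin.punchInᵢ≢i i j)) ⟩
  t i +ℝ 0ℝ                            ≈⟨ +-identityʳ (t i) ⟩
  t i                                  ∎

dot : Vector ℝ m → Vector ℝ m → ℝ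
dot p x = sum λ j → p j *ℝ x j

dot-congˡ : (p : Vector ℝ m) {x y : Vector ℝ m} → x ≋ y → dot p x ≈ℝ dot p y
dot-congˡ p x≋y = sum-cong-≋ λ j → *-congˡ (x≋y j)

dot-congʳ : (x : Vector ℝ m) {p q : Vector ℝ m} → p ≋ q → dot p x ≈ℝ dot q x
dot-congʳ x p≋q = sum-cong-≋ λ j → *-congʳ (p≋q j)

dot-comm : (p x : Vector ℝ m) → dot p x ≈ℝ dot x p
dot-comm p x = sum-cong-≋ λ j → *-comm (p j) (x j)

dot-scale : (p : Vector ℝ m) (μ : ℝ) (x : Vector ℝ m) →
            dot p (λ j → μ *ℝ x j) ≈ℝ μ *ℝ dot p x
dot-scale p μ x = trans
  (sum-cong-≋ λ j → x∙yz≈y∙xz (p j) μ (x j))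
  (sym (*-distribˡ-sum μ (λ j → p j *ℝ x j)))

dot-swap : (p : Vector ℝ m) (a : Vector ℝ n) (N : Fin m → Fin n → ℝ) →
           dot p (λ j → dot a (N j)) ≈ℝ dot a (λ s → dot p (flip N s))
dot-swap p a N = begin
  dot p (λ j → dot a (N j))
    ≈⟨ sum-cong-≋ (λ j → *-distribˡ-sum (p j) (λ s → a s *ℝ N j s)) ⟩
  sum (λ j → sum λ s → p j *ℝ (a s *ℝ N j s))
    ≈⟨ ∑-comm (λ j s → p j *ℝ (a s *ℝ N j s)) ⟩
  sum (λ s → sum λ j → p j *ℝ (a s *ℝ N j s))
    ≈⟨ sum-cong-≋ (λ s → dot-scale p (a s) (flip N s)) ⟩
  dot a (λ s → dot p (flip N s)) ∎

dot-assoc : (p : Vector ℝ m) (N : Fin m → Fin n → ℝ) (x : Vector ℝ n) →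
            dot p (λ j → dot (N j) x) ≈ℝ dot (λ s → dot p (flip N s)) x
dot-assoc p N x = begin
  dot p (λ j → dot (N j) x)        ≈⟨ dot-congˡ p (λ j → dot-comm (N j) x) ⟩
  dot p (λ j → dot x (N j))        ≈⟨ dot-swap p x N ⟩
  dot x (λ s → dot p (flip N s))   ≈⟨ dot-comm x (λ s → dot p (flip N s)) ⟩
  dot (λ s → dot p (flip N s)) x   ∎

dot-+ : (p x y : Vector ℝ m) → dot p (λ j → x j +ℝ y j) ≈ℝ dot p x +ℝ dot p y
dot-+ p x y = trans
  (sum-cong-≋ λ j → distribˡ (p j) (x j) (y j))
  (∑-distrib-+ (λ j → p j *ℝ x j) (λ j → p j *ℝ y j))

dot-shift : (p x : Vector ℝ m) (r : ℝ) → sum p ≈ℝ 1ℝ →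
            dot p (λ j → x j +ℝ r) ≈ℝ dot p x +ℝ r
dot-shift p x r sum≈1 = begin
  dot p (λ j → x j +ℝ r)        ≈⟨ dot-+ p x (λ _ → r) ⟩
  dot p x +ℝ dot p (λ _ → r)    ≈⟨ +-congˡ (*-distribʳ-sum r p) ⟨
  dot p x +ℝ sum p *ℝ r         ≈⟨ +-congˡ (trans (*-congʳ sum≈1) (*-identityˡ r)) ⟩
  dot p x +ℝ r                  ∎

δ : Fin m → Fin m → ℝ
δ i j = 1ℝ when (i Fin.≟ j)

dot-δ : (i : Fin m) (x : Vector ℝ m) → dot (δ i) x ≈ℝ x i
dot-δ i x = trans
  (sum-single _ i λ j j≢i → trans (*-congʳ (when-no (i Fin.≟ j) (j≢i ∘ ≡.sym))) (zeroˡ (x j)))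
  (trans (*-congʳ (when-yes (i Fin.≟ i) ≡.refl)) (*-identityˡ (x i)))

-- Similar matrices have the same spectrum

record IsLinear {n} (T : Vector ℝ n → Vector ℝ n) : Set where
  field
    cong    : ∀ {x y} → x ≋ y → T x ≋ T y
    scale   : ∀ μ x → T (λ i → μ *ℝ x i) ≋ λ i → μ *ℝ T x i
    combine : ∀ {k} (a : Vector ℝ k) b → T (combination a b) ≋ combination a (T ∘ b)

Intertwines : (Vector ℝ n → Vector ℝ n) → Matrix n → Matrix n → Set
Intertwines T M M′ = ∀ x → T (M · x) ≋ M′ · T x

module _ {T S : Vector ℝ n → Vector ℝ n} (T-linear : IsLinear T) (S-linear : IsLinear S)
         (S∘T : ∀ x → S (T x) ≋ x) (T∘S : ∀ x → T (S x) ≋ x) where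

  private
    module T = IsLinear T-linear
    module S = IsLinear S-linear

  inverse-intertwines : ∀ {M M′} → Intertwines T M M′ → Intertwines S M′ M
  inverse-intertwines {M} {M′} TM≋M′T y = ≋-trans
    (S.cong λ i → trans (dot-congˡ (M′ i) (λ j → sym (T∘S y j))) (sym (TM≋M′T (S y) i)))
    (S∘T (M · S y))

  multiplicity-transfer : ∀ {M M′ μ} → Intertwines T M M′ → Intertwines S M′ M →
                          HasMultiplicity M μ k → HasMultiplicity M′ μ k
  multiplicity-transfer {M = M} {M′} {μ} TM≋M′T SM′≋MS h = record
    { basis       = T ∘ basis
    ; eigen       = λ s i → trans (sym (TM≋M′T (basis s) i))
                      (≋-trans (T.cong (eigen s)) (T.scale μ (basis s)) i)
    ; independent = λ a a·Tb≋0 → independent a λ i → begin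
        combination a basis i            ≈⟨ S∘T (combination a basis) i ⟨
        S (T (combination a basis)) i    ≈⟨ S.cong (≋-trans (T.combine a basis) a·Tb≋0) i ⟩
        S (λ _ → 0ℝ) i                   ≈⟨ S.cong (λ _ → sym (zeroˡ 0ℝ)) i ⟩
        S (λ _ → 0ℝ *ℝ 0ℝ) i             ≈⟨ S.scale 0ℝ (λ _ → 0ℝ) i ⟩
        0ℝ *ℝ S (λ _ → 0ℝ) i             ≈⟨ zeroˡ (S (λ _ → 0ℝ) i) ⟩
        0ℝ                               ∎
    ; spanning    = λ x x∈ →
        let a , Sx≋a·b = spanning (S x) λ i → trans (sym (SM′≋MS x i))
                           (≋-trans (S.cong x∈) (S.scale μ x) i)
        in a , λ i → begin
          x i                         ≈⟨ T∘S x i ⟨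
          T (S x) i                   ≈⟨ T.cong Sx≋a·b i ⟩
          T (combination a basis) i   ≈⟨ T.combine a basis i ⟩
          combination a (T ∘ basis) i ∎
    }
    where open HasMultiplicity h

similar⇒sameSpectrum : ∀ {T S : Vector ℝ n → Vector ℝ n} {M M′} →
  IsLinear T → IsLinear S → (∀ x → S (T x) ≋ x) → (∀ x → T (S x) ≋ x) →
  Intertwines T M M′ → SameSpectrum M M′
similar⇒sameSpectrum {M = M} {M′} T-lin S-lin S∘T T∘S TM≋M′T μ k = mk⇔
  (multiplicity-transfer T-lin S-lin S∘T T∘S TM≋M′T SM′≋MS)
  (multiplicity-transfer S-lin T-lin T∘S S∘T SM′≋MS TM≋M′T)
  where SM′≋MS = inverse-intertwines T-lin S-lin S∘T T∘S {M} {M′} TM≋M′T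

-- Operators acting on a block of coordinates

module Block (v : Fin m → Fin n) (v-injective : Injective _≡_ _≡_ v) where

  Member : Fin n → Set
  Member u = ∃[ i ] v i ≡ u

  member? : ∀ u → Dec (Member u)
  member? u = Fin.any? λ i → v i Fin.≟ u

  outside : Vector ℝ n → Vector ℝ n
  outside x u = x u when ¬? (member? u)

  block-ext : {x y : Vector ℝ n} → (∀ i → x (v i) ≈ℝ y (v i)) →
              (∀ u → ¬ Member u → x u ≈ℝ y u) → x ≋ y
  block-ext on off u with member? u
  ... | yes (i , ≡.refl) = on i
  ... | no u∉            = off u u∉

  outside-member : ∀ x i → outside x (v i) ≈ℝ 0ℝ
  outside-member x i = when-no (¬? (member? (v i))) λ ∉ → ∉ (i , ≡.refl)

  outside-nonmember : ∀ x u → ¬ Member u → outside x u ≈ℝ x u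
  outside-nonmember x u = when-yes (¬? (member? u))

  dot-outside-cong : {p q x y : Vector ℝ n} →
    (∀ u → ¬ Member u → p u ≈ℝ q u) → (∀ u → ¬ Member u → x u ≈ℝ y u) →
    dot p (outside x) ≈ℝ dot q (outside y)
  dot-outside-cong {p} {q} {x} {y} p≈q x≈y = sum-cong-≋ (block-ext
    (λ i → trans (vanish p x i) (sym (vanish q y i)))
    (λ u u∉ → *-cong (p≈q u u∉) (begin
      outside x u   ≈⟨ outside-nonmember x u u∉ ⟩
      x u           ≈⟨ x≈y u u∉ ⟩
      y u           ≈⟨ outside-nonmember y u u∉ ⟨
      outside y u   ∎)))
    where
    vanish : ∀ p x i → p (v i) *ℝ outside x (v i) ≈ℝ 0ℝ
    vanish p x i = trans (*-congˡ (outside-member x i)) (zeroʳ (p (v i)))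

  dot-split : ∀ p x → dot p x ≈ℝ dot (p ∘ v) (x ∘ v) +ℝ dot p (outside x)
  dot-split p x = begin
    dot p x
      ≈⟨ sum-cong-≋ (block-ext on off) ⟩
    sum (λ u → sum (λ j → χ j u) +ℝ p u *ℝ outside x u)
      ≈⟨ ∑-distrib-+ (λ u → sum λ j → χ j u) (λ u → p u *ℝ outside x u) ⟩
    sum (λ u → sum λ j → χ j u) +ℝ dot p (outside x)
      ≈⟨ +-congʳ (∑-comm (λ u j → χ j u)) ⟩
    sum (λ j → sum (χ j)) +ℝ dot p (outside x)
      ≈⟨ +-congʳ (sum-cong-≋ λ j → trans
           (sum-single (χ j) (v j) λ u u≢ → when-no (v j Fin.≟ u) (u≢ ∘ ≡.sym))
           (when-yes (v j Fin.≟ v j) ≡.refl)) ⟩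
    dot (p ∘ v) (x ∘ v) +ℝ dot p (outside x) ∎
    where
    χ : Fin m → Vector ℝ n
    χ j u = p u *ℝ x u when (v j Fin.≟ u)
    on : ∀ i → p (v i) *ℝ x (v i) ≈ℝ
               sum (λ j → χ j (v i)) +ℝ p (v i) *ℝ outside x (v i)
    on i = sym (begin
      sum (λ j → χ j (v i)) +ℝ p (v i) *ℝ outside x (v i)
        ≈⟨ +-cong
             (trans
               (sum-single _ i λ j j≢i → when-no (v j Fin.≟ v i) (j≢i ∘ v-injective))
               (when-yes (v i Fin.≟ v i) ≡.refl))
             (trans (*-congˡ (outside-member x i)) (zeroʳ (p (v i)))) ⟩
      p (v i) *ℝ x (v i) +ℝ 0ℝ
        ≈⟨ +-identityʳ _ ⟩
      p (v i) *ℝ x (v i) ∎)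
    off : ∀ u → ¬ Member u → p u *ℝ x u ≈ℝ sum (λ j → χ j u) +ℝ p u *ℝ outside x u
    off u u∉ = sym (begin
      sum (λ j → χ j u) +ℝ p u *ℝ outside x u
        ≈⟨ +-cong
             (sum-zero λ j → when-no (v j Fin.≟ u) λ e → u∉ (j , e))
             (*-congˡ (outside-nonmember x u u∉)) ⟩
      0ℝ +ℝ p u *ℝ x u
        ≈⟨ +-identityˡ _ ⟩
      p u *ℝ x u ∎)

  actAt : Matrix m → Vector ℝ n → ∀ u → Dec (Member u) → ℝ
  actAt Q x u (yes (i , _)) = dot (Q i) (x ∘ v)
  actAt Q x u (no _)        = x u

  act : Matrix m → Vector ℝ n → Vector ℝ n
  act Q x u = actAt Q x u (member? u)

  act-member : ∀ Q x i → act Q x (v i) ≈ℝ dot (Q i) (x ∘ v)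
  act-member Q x i = at (member? (v i))
    where
    at : ∀ d → actAt Q x (v i) d ≈ℝ dot (Q i) (x ∘ v)
    at (yes (j , e)) with v-injective e
    ... | ≡.refl = refl
    at (no ∉) = contradiction (i , ≡.refl) ∉

  act-nonmember : ∀ Q x u → ¬ Member u → act Q x u ≈ℝ x u
  act-nonmember Q x u u∉ = at (member? u)
    where
    at : ∀ d → actAt Q x u d ≈ℝ x u
    at (yes u∈) = contradiction u∈ u∉
    at (no _)   = refl

  act-linear : ∀ Q → IsLinear (act Q)
  act-linear Q = record
    { cong    = λ {x} {y} x≋y u → cong-at x y x≋y u (member? u)
    ; scale   = λ μ x u → scale-at μ x u (member? u)
    ; combine = λ a b u → combine-at a b u (member? u)
    }
    where
    cong-at : ∀ x y → x ≋ y → ∀ u d → actAt Q x u d ≈ℝ actAt Q y u d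
    cong-at x y x≋y u (yes (i , _)) = dot-congˡ (Q i) (x≋y ∘ v)
    cong-at x y x≋y u (no _)        = x≋y u
    scale-at : ∀ μ x u d → actAt Q (λ w → μ *ℝ x w) u d ≈ℝ μ *ℝ actAt Q x u d
    scale-at μ x u (yes (i , _)) = dot-scale (Q i) μ (x ∘ v)
    scale-at μ x u (no _)        = refl
    combine-at : ∀ {k} (a : Vector ℝ k) b u d →
                 actAt Q (combination a b) u d ≈ℝ dot a (λ s → actAt Q (b s) u d)
    combine-at a b u (yes (i , _)) = dot-swap (Q i) a (λ j s → b s (v j))
    combine-at a b u (no _)        = refl

  act-inverse : ∀ P Q → (∀ i j → dot (P i) (flip Q j) ≈ℝ δ i j) →
                ∀ x → act P (act Q x) ≋ x
  act-inverse P Q PQ≈δ x = block-ext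
    (λ i → begin
      act P (act Q x) (v i)
        ≈⟨ act-member P (act Q x) i ⟩
      dot (P i) (act Q x ∘ v)
        ≈⟨ dot-congˡ (P i) (act-member Q x) ⟩
      dot (P i) (λ j → dot (Q j) (x ∘ v))
        ≈⟨ dot-assoc (P i) Q (x ∘ v) ⟩
      dot (λ s → dot (P i) (flip Q s)) (x ∘ v)
        ≈⟨ dot-congʳ (x ∘ v) (PQ≈δ i) ⟩
      dot (δ i) (x ∘ v)
        ≈⟨ dot-δ i (x ∘ v) ⟩
      x (v i) ∎)
    (λ u u∉ → trans (act-nonmember P (act Q x) u u∉) (act-nonmember Q x u u∉))

  -- The four blocks of the equation T M = M′ T, where T is the direct sum of Q
  -- and an identity matrix.
  record Switched (Q : Matrix m) (M M′ : Matrix n) : Set where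
    field
      off-off : ∀ u w → ¬ Member u → ¬ Member w → M u w ≈ℝ M′ u w
      off-on  : ∀ u → ¬ Member u → ∀ k → dot (M′ u ∘ v) (flip Q k) ≈ℝ M u (v k)
      on-off  : ∀ w → ¬ Member w → ∀ i → dot (Q i) (λ j → M (v j) w) ≈ℝ M′ (v i) w
      on-on   : ∀ i k → dot (Q i) (λ j → M (v j) (v k)) ≈ℝ dot (M′ (v i) ∘ v) (flip Q k)

  act-intertwines : ∀ {Q M M′} → Switched Q M M′ → Intertwines (act Q) M M′
  act-intertwines {Q} {M} {M′} sw x = block-ext
    (λ i → begin
      act Q (M · x) (v i)
        ≈⟨ act-member Q (M · x) i ⟩
      dot (Q i) (λ j → dot (M (v j)) x)
        ≈⟨ dot-congˡ (Q i) (λ j → dot-split (M (v j)) x) ⟩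
      dot (Q i) (λ j → dot (M (v j) ∘ v) (x ∘ v) +ℝ dot (M (v j)) (outside x))
        ≈⟨ dot-+ (Q i) (λ j → dot (M (v j) ∘ v) (x ∘ v)) (λ j → dot (M (v j)) (outside x)) ⟩
      dot (Q i) (λ j → dot (M (v j) ∘ v) (x ∘ v)) +ℝ dot (Q i) (λ j → dot (M (v j)) (outside x))
        ≈⟨ +-cong (dot-assoc (Q i) (λ j → M (v j) ∘ v) (x ∘ v))
                  (dot-assoc (Q i) (λ j → M (v j)) (outside x)) ⟩
      dot (λ k → dot (Q i) (λ j → M (v j) (v k))) (x ∘ v) +ℝ
        dot (λ w → dot (Q i) (λ j → M (v j) w)) (outside x)
        ≈⟨ +-cong (dot-congʳ (x ∘ v) (on-on i))
                  (dot-outside-cong (λ w w∉ → on-off w w∉ i) (λ w _ → refl)) ⟩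
      dot (λ k → dot (M′ (v i) ∘ v) (flip Q k)) (x ∘ v) +ℝ dot (M′ (v i)) (outside x)
        ≈⟨ row-act (v i) ⟨
      (M′ · act Q x) (v i) ∎)
    (λ u u∉ → begin
      act Q (M · x) u
        ≈⟨ act-nonmember Q (M · x) u u∉ ⟩
      dot (M u) x
        ≈⟨ dot-split (M u) x ⟩
      dot (M u ∘ v) (x ∘ v) +ℝ dot (M u) (outside x)
        ≈⟨ +-cong (dot-congʳ (x ∘ v) λ k → sym (off-on u u∉ k))
                  (dot-outside-cong (λ w w∉ → off-off u w u∉ w∉) (λ w _ → refl)) ⟩
      dot (λ k → dot (M′ u ∘ v) (flip Q k)) (x ∘ v) +ℝ dot (M′ u) (outside x)
        ≈⟨ row-act u ⟨
      (M′ · act Q x) u ∎)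
    where
    open Switched sw
    row-act : ∀ u → dot (M′ u) (act Q x) ≈ℝ
      dot (λ k → dot (M′ u ∘ v) (flip Q k)) (x ∘ v) +ℝ dot (M′ u) (outside x)
    row-act u = begin
      dot (M′ u) (act Q x)
        ≈⟨ dot-split (M′ u) (act Q x) ⟩
      dot (M′ u ∘ v) (act Q x ∘ v) +ℝ dot (M′ u) (outside (act Q x))
        ≈⟨ +-cong (dot-congˡ (M′ u ∘ v) (act-member Q x))
                  (dot-outside-cong (λ _ _ → refl) (act-nonmember Q x)) ⟩
      dot (M′ u ∘ v) (λ j → dot (Q j) (x ∘ v)) +ℝ dot (M′ u) (outside x)
        ≈⟨ +-congʳ (dot-assoc (M′ u ∘ v) Q (x ∘ v)) ⟩
      dot (λ k → dot (M′ u ∘ v) (flip Q k)) (x ∘ v) +ℝ dot (M′ u) (outside x) ∎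

  switched-shift : ∀ {Q M M′} → (∀ i → sum (Q i) ≈ℝ 1ℝ) → (∀ k → sum (flip Q k) ≈ℝ 1ℝ) →
                   ∀ r → Switched Q M M′ → Switched Q (M +[ r ]J) (M′ +[ r ]J)
  switched-shift {Q} {M} {M′} rows columns r sw = record
    { off-off = λ u w u∉ w∉ → +-congʳ (off-off u w u∉ w∉)
    ; off-on  = λ u u∉ k → trans (shiftʳ (M′ u ∘ v) k) (+-congʳ (off-on u u∉ k))
    ; on-off  = λ w w∉ i → trans (shiftˡ i λ j → M (v j) w) (+-congʳ (on-off w w∉ i))
    ; on-on   = λ i k → trans (shiftˡ i λ j → M (v j) (v k))
                  (trans (+-congʳ (on-on i k)) (sym (shiftʳ (M′ (v i) ∘ v) k)))
    }
    where
    open Switched sw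
    shiftˡ : ∀ i x → dot (Q i) (λ j → x j +ℝ r) ≈ℝ dot (Q i) x +ℝ r
    shiftˡ i x = dot-shift (Q i) x r (rows i)
    shiftʳ : ∀ x k → dot (λ j → x j +ℝ r) (flip Q k) ≈ℝ dot x (flip Q k) +ℝ r
    shiftʳ x k = trans (dot-comm (λ j → x j +ℝ r) (flip Q k))
      (trans (dot-shift (flip Q k) x r (columns k)) (+-congʳ (dot-comm (flip Q k) x)))

-- The rational orthogonal matrix of the Fano plane

dotℚ : Vector ℚ m → Vector ℚ m → ℚ
dotℚ p x = sumℚ λ j → p j ℚ.* x j

-- fromℚ (a ℚ.+ b) and fromℚ a +ℝ fromℚ b have the same underlying sequence but
-- are not definitionally equal, and likewise for products.
fromℚ-+ : ∀ a b → fromℚ a +ℝ fromℚ b ≈ℝ fromℚ (a ℚ.+ b)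
fromℚ-+ a b = mk≈ (_≈ℝ_.null (refl {fromℚ (a ℚ.+ b)}))

fromℚ-* : ∀ a b → fromℚ a *ℝ fromℚ b ≈ℝ fromℚ (a ℚ.* b)
fromℚ-* a b = mk≈ (_≈ℝ_.null (refl {fromℚ (a ℚ.* b)}))

fromℚ-sum : (p : Vector ℚ m) → sum (fromℚ ∘ p) ≈ℝ fromℚ (sumℚ p)
fromℚ-sum {zero}  p = refl
fromℚ-sum {suc m} p = trans (+-congˡ (fromℚ-sum (p ∘ Fin.suc))) (fromℚ-+ _ _)

fromℚ-dot : (p x : Vector ℚ m) → dot (fromℚ ∘ p) (fromℚ ∘ x) ≈ℝ fromℚ (dotℚ p x)
fromℚ-dot p x = trans
  (sum-cong-≋ λ j → fromℚ-* (p j) (x j)) (fromℚ-sum λ j → p j ℚ.* x j)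

bit : Bool → ℚ
bit b = if b then 1ℚ else 0ℚ

fromℚ-bit : ∀ b → fromℚ (bit b) ≡ (if b then 1ℝ else 0ℝ)
fromℚ-bit true  = ≡.refl
fromℚ-bit false = ≡.refl

rotationℚ : ℤ/7 → ℤ/7 → ℚ
rotationℚ i j =
  if lookup (ℓ j) i then ½ else if does (i Fin.≟ j) then ℚ.- ½ else 0ℚ

rotation : Matrix 7
rotation i j = fromℚ (rotationℚ i j)

Orthonormal : (Fin m → Vector ℚ n) → Set
Orthonormal Q = ∀ i j → dotℚ (Q i) (Q j) ≡ bit (does (i Fin.≟ j))

orthonormal? : (Q : Fin m → Vector ℚ n) → Dec (Orthonormal Q)
orthonormal? Q = Fin.all? λ i → Fin.all? λ j → dotℚ (Q i) (Q j) ℚ.≟ bit (does (i Fin.≟ j))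

HasUnitSums : (Fin m → Vector ℚ n) → Set
HasUnitSums Q = ∀ i → sumℚ (Q i) ≡ 1ℚ

hasUnitSums? : (Q : Fin m → Vector ℚ n) → Dec (HasUnitSums Q)
hasUnitSums? Q = Fin.all? λ i → sumℚ (Q i) ℚ.≟ 1ℚ

RotatesTo : Subset 7 → Subset 7 → Set
RotatesTo S S′ = ∀ k →
  dotℚ (rotationℚ k) (bit ∘ lookup S) ≡ bit (lookup S′ k) ×
  dotℚ (bit ∘ lookup S′) (flip rotationℚ k) ≡ bit (lookup S k)

rotatesTo? : ∀ S S′ → Dec (RotatesTo S S′)
rotatesTo? S S′ = Fin.all? λ k →
  (dotℚ (rotationℚ k) (bit ∘ lookup S) ℚ.≟ bit (lookup S′ k)) ×-dec
  (dotℚ (bit ∘ lookup S′) (flip rotationℚ k) ℚ.≟ bit (lookup S k))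

switchedEdges : Case → EdgeSet
switchedEdges caseA = edges caseA
switchedEdges caseB = newEdges

edgeBit : EdgeSet → ℤ/7 → ℤ/7 → ℚ
edgeBit E i j = bit (does (joined? E i j))

RotatesEdges : EdgeSet → EdgeSet → Set
RotatesEdges E E′ = ∀ i k →
  dotℚ (rotationℚ i) (flip (edgeBit E) k) ≡ dotℚ (edgeBit E′ i) (flip rotationℚ k)

rotatesEdges? : ∀ E E′ → Dec (RotatesEdges E E′)
rotatesEdges? E E′ = Fin.all? λ i → Fin.all? λ k →
  dotℚ (rotationℚ i) (flip (edgeBit E) k) ℚ.≟ dotℚ (edgeBit E′ i) (flip rotationℚ k)

abstract
  rotation-rows : Orthonormal rotationℚ
  rotation-rows = from-yes (orthonormal? rotationℚ)

  rotation-columns : Orthonormal (flip rotationℚ)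
  rotation-columns = from-yes (orthonormal? (flip rotationℚ))

  rotation-rowSums : HasUnitSums rotationℚ
  rotation-rowSums = from-yes (hasUnitSums? rotationℚ)

  rotation-columnSums : HasUnitSums (flip rotationℚ)
  rotation-columnSums = from-yes (hasUnitSums? (flip rotationℚ))

  admissible-rotates : ∀ {S} → Admissible S → RotatesTo S (switchNbhd S)
  admissible-rotates full       = from-yes (rotatesTo? ⊤ (switchNbhd ⊤))
  admissible-rotates empty      = from-yes (rotatesTo? ⊥ (switchNbhd ⊥))
  admissible-rotates (line i)   =
    from-yes (Fin.all? λ i → rotatesTo? (ℓ i) (switchNbhd (ℓ i))) i
  admissible-rotates (coline i) =
    from-yes (Fin.all? λ i → rotatesTo? (∁ (ℓ i)) (switchNbhd (∁ (ℓ i)))) i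

  edges-rotate : ∀ c → RotatesEdges (edges c) (switchedEdges c)
  edges-rotate caseA = from-yes (rotatesEdges? (edges caseA) (edges caseA))
  edges-rotate caseB = from-yes (rotatesEdges? (edges caseB) newEdges)

orthonormal⇒δ : (Q : Fin m → Vector ℚ n) → Orthonormal Q →
                ∀ i j → dot (fromℚ ∘ Q i) (fromℚ ∘ Q j) ≈ℝ δ i j
orthonormal⇒δ Q orth i j = trans (fromℚ-dot (Q i) (Q j))
  (reflexive (≡.trans (≡.cong fromℚ (orth i j)) (fromℚ-bit _)))

hasUnitSums⇒sum≈1 : (Q : Fin m → Vector ℚ n) → HasUnitSums Q → ∀ i → sum (fromℚ ∘ Q i) ≈ℝ 1ℝ
hasUnitSums⇒sum≈1 Q unit i =
  trans (fromℚ-sum (Q i)) (reflexive (≡.cong fromℚ (unit i)))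

⇔-does : ∀ {A : Set} {b} → b ≡ true ⇔ A → (d : Dec A) → b ≡ does d
⇔-does {b = true}  b⇔A d = ≡.sym (dec-true d (Equivalence.to b⇔A ≡.refl))
⇔-does {b = false} b⇔A d = ≡.sym (dec-false d λ a → contradiction (Equivalence.from b⇔A a) λ ())

module Switching {n} (Γ : Graph n) (v : ℤ/7 → Fin n) (v-injective : Injective _≡_ _≡_ v)
                 (c : Case) (induces : Induces Γ v (edges c)) where

  open Block v v-injective

  private
    Γ′ : Graph n
    Γ′ = fanoSwitch Γ v c

  inside-before : ∀ i j → adj Γ (v i) (v j) ≡ does (joined? (edges c) i j)
  inside-before i j = ⇔-does (induces i j) (joined? (edges c) i j)

  insideAdj-joined : ∀ c → Induces Γ v (edges c) → ∀ i j →
                     insideAdj Γ v c i j ≡ does (joined? (switchedEdges c) i j)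
  insideAdj-joined caseA ind i j = ⇔-does (ind i j) (joined? (edges caseA) i j)
  insideAdj-joined caseB ind i j = ≡.refl

  inside-after : ∀ i j → adj Γ′ (v i) (v j) ≡ does (joined? (switchedEdges c) i j)
  inside-after i j = at (inC? v (v i)) (inC? v (v j))
    where
    at : (d : Dec (InC v (v i))) (e : Dec (InC v (v j))) →
         switchAdj Γ v c d e ≡ does (joined? (switchedEdges c) i j)
    at (yes (i′ , p)) (yes (j′ , q)) with v-injective p | v-injective q
    ... | ≡.refl | ≡.refl = insideAdj-joined c induces i j
    at (no ∉) _               = contradiction (i , ≡.refl) ∉
    at (yes _) (no ∉)         = contradiction (j , ≡.refl) ∉

  across-after : ∀ u → ¬ InC v u → ∀ j → adj Γ′ u (v j) ≡ lookup (switchNbhd (nbhd Γ v u)) j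
  across-after u u∉ j = at (inC? v u) (inC? v (v j))
    where
    at : (d : Dec (InC v u)) (e : Dec (InC v (v j))) →
         switchAdj Γ v c d e ≡ lookup (switchNbhd (nbhd Γ v u)) j
    at (no _)   (yes (j′ , q)) with v-injective q
    ... | ≡.refl = ≡.refl
    at (yes u∈) _              = contradiction u∈ u∉
    at (no _)   (no ∉)         = contradiction (j , ≡.refl) ∉

  outside-after : ∀ u w → ¬ InC v u → ¬ InC v w → adj Γ′ u w ≡ adj Γ u w
  outside-after u w u∉ w∉ = at (inC? v u) (inC? v w)
    where
    at : (d : Dec (InC v u)) (e : Dec (InC v w)) → switchAdj Γ v c d e ≡ adj Γ u w
    at (no _)   (no _)   = ≡.refl
    at (yes u∈) _        = contradiction u∈ u∉
    at (no _)   (yes w∈) = contradiction w∈ w∉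

  adjacency-bit : ∀ (Δ : Graph n) u w {b} → adj Δ u w ≡ b → adjacency Δ u w ≈ℝ fromℚ (bit b)
  adjacency-bit Δ u w ≡.refl = reflexive (≡.sym (fromℚ-bit (adj Δ u w)))

  across-before : ∀ u j → adj Γ u (v j) ≡ lookup (nbhd Γ v u) j
  across-before u j = ≡.sym (lookup∘tabulate (λ i → adj Γ u (v i)) j)

  adjacency-switched : (∀ u → ¬ InC v u → Admissible (nbhd Γ v u)) →
                       Switched rotation (adjacency Γ) (adjacency Γ′)
  adjacency-switched admissible = record
    { off-off = λ u w u∉ w∉ → reflexive
        (≡.cong (λ b → if b then 1ℝ else 0ℝ) (≡.sym (outside-after u w u∉ w∉)))
    ; off-on  = λ u u∉ k → begin
        dot (adjacency Γ′ u ∘ v) (flip rotation k)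
          ≈⟨ dot-congʳ (flip rotation k) (λ j → adjacency-bit Γ′ u (v j) (across-after u u∉ j)) ⟩
        dot (λ j → fromℚ (bit (lookup (switchNbhd (nbhd Γ v u)) j))) (flip rotation k)
          ≈⟨ fromℚ-dot (bit ∘ lookup (switchNbhd (nbhd Γ v u))) (flip rotationℚ k) ⟩
        fromℚ (dotℚ (bit ∘ lookup (switchNbhd (nbhd Γ v u))) (flip rotationℚ k))
          ≡⟨ ≡.cong fromℚ (proj₂ (admissible-rotates (admissible u u∉) k)) ⟩
        fromℚ (bit (lookup (nbhd Γ v u) k))
          ≈⟨ adjacency-bit Γ u (v k) (across-before u k) ⟨
        adjacency Γ u (v k) ∎
    ; on-off  = λ w w∉ i → begin
        dot (rotation i) (λ j → adjacency Γ (v j) w)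
          ≈⟨ dot-congˡ (rotation i) (λ j → adjacency-bit Γ (v j) w
               (≡.trans (adj-sym Γ (v j) w) (across-before w j))) ⟩
        dot (rotation i) (λ j → fromℚ (bit (lookup (nbhd Γ v w) j)))
          ≈⟨ fromℚ-dot (rotationℚ i) (bit ∘ lookup (nbhd Γ v w)) ⟩
        fromℚ (dotℚ (rotationℚ i) (bit ∘ lookup (nbhd Γ v w)))
          ≡⟨ ≡.cong fromℚ (proj₁ (admissible-rotates (admissible w w∉) i)) ⟩
        fromℚ (bit (lookup (switchNbhd (nbhd Γ v w)) i))
          ≈⟨ adjacency-bit Γ′ (v i) w
               (≡.trans (adj-sym Γ′ (v i) w) (across-after w w∉ i)) ⟨
        adjacency Γ′ (v i) w ∎
    ; on-on   = λ i k → begin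
        dot (rotation i) (λ j → adjacency Γ (v j) (v k))
          ≈⟨ dot-congˡ (rotation i) (λ j → adjacency-bit Γ (v j) (v k) (inside-before j k)) ⟩
        dot (rotation i) (λ j → fromℚ (edgeBit (edges c) j k))
          ≈⟨ fromℚ-dot (rotationℚ i) (flip (edgeBit (edges c)) k) ⟩
        fromℚ (dotℚ (rotationℚ i) (flip (edgeBit (edges c)) k))
          ≡⟨ ≡.cong fromℚ (edges-rotate c i k) ⟩
        fromℚ (dotℚ (edgeBit (switchedEdges c) i) (flip rotationℚ k))
          ≈⟨ fromℚ-dot (edgeBit (switchedEdges c) i) (flip rotationℚ k) ⟨
        dot (λ j → fromℚ (edgeBit (switchedEdges c) i j)) (flip rotation k)
          ≈⟨ dot-congʳ (flip rotation k)
               (λ j → adjacency-bit Γ′ (v i) (v j) (inside-after i j)) ⟨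
        dot (adjacency Γ′ (v i) ∘ v) (flip rotation k) ∎
    }

theorem25 : ∀ {n} (Γ : Graph n) (v : ℤ/7 → Fin n) → Injective _≡_ _≡_ v →
    ∀ (c : Case) → Induces Γ v (edges c) →
    (∀ u → ¬ InC v u → Admissible (nbhd Γ v u)) →
    ℝ-Cospectral Γ (fanoSwitch Γ v c)
theorem25 Γ v v-injective c induces admissible r = similar⇒sameSpectrum
  (act-linear rotation) (act-linear (flip rotation))
  (act-inverse (flip rotation) rotation (orthonormal⇒δ (flip rotationℚ) rotation-columns))
  (act-inverse rotation (flip rotation) (orthonormal⇒δ rotationℚ rotation-rows))
  (act-intertwines (switched-shift
    (hasUnitSums⇒sum≈1 rotationℚ rotation-rowSums)
    (hasUnitSums⇒sum≈1 (flip rotationℚ) rotation-columnSums)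
    r (Switching.adjacency-switched Γ v v-injective c induces admissible)))
  where open Block v v-injective
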